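{- For every integer $n\ge 2$ with $n\ne 3$, there exists a covering circuit of $G_n^2$ whose link length equals the minimum link length of a covering trail of $G_n^2$ (that is, $3$ if $n=2$ and $2(n-1)$ if $n\ge 4$).
   Context: For a positive integer $n$, let $G_n^2=\{0,1,\ldots,n-1\}\times\{0,1,\ldots,n-1\}\subset\mathbb{R}^2$. A covering trail of $G_n^2$ is a directed polygonal chain in $\mathbb{R}^2$ (a finite sequence of points, consecutive ones joined by line segments called edges) that passes through every point of $G_n^2$ at least once, in which no edge is repeated and no two consecutive edges are collinear; its vertices need not be grid points. A covering circuit is a covering trail whose starting point equals its endpoint (grid points may be visited more than once). The link length of a trail is its number of edges. It is known that the minimum link length of a covering trail of $G_n^2$ is $1$ for $n=1$, $3$ for $n=2$, and $2(n-1)$ for $n\ge 3$. -}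

module Defs where

open import Data.Nat as ℕ using (ℕ; zero; suc)
open import Data.Integer using (+_)
open import Data.Rational using (ℚ; _+_; _*_; _-_; _≤_; 0ℚ; 1ℚ; _/_)
open import Data.Fin using (Fin; toℕ; inject₁; fromℕ) renaming (suc to fsuc; zero to fzero)
open import Data.Product using (_×_; _,_; ∃-syntax; Σ-syntax)
open import Relation.Binary.PropositionalEquality using (_≡_; _≢_)
open import Data.Sum using (_⊎_)
open import Relation.Nullary using (¬_)

Point : Set
Point = ℚ × ℚ

ℕtoℚ : ℕ → ℚ
ℕtoℚ k = + k / 1

gridPoint : {n : ℕ} → Fin n → Fin n → Point
gridPoint i j = (ℕtoℚ (toℕ i) , ℕtoℚ (toℕ j))

cross : Point → Point → Point → ℚ
cross (px , py) (qx , qy) (rx , ry) = (qx - px) * (ry - py) - (qy - py) * (rx - px)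

Collinear : Point → Point → Point → Set
Collinear p q r = cross p q r ≡ 0ℚ

OnSegment : Point → Point → Point → Set
OnSegment (px , py) (qx , qy) (gx , gy) =
  Σ[ t ∈ ℚ ] (0ℚ ≤ t × t ≤ 1ℚ ×
              gx ≡ px + t * (qx - px) × gy ≡ py + t * (qy - py))

-- A polygonal chain with k edges is given by its k+1 vertices
-- p 0 , p 1 , … , p k ; edge number i (i < k) joins p i and p (i+1).
Chain : ℕ → Set
Chain k = Fin (suc k) → Point

start : ∀ {k} → Chain k → Fin k → Point
start p i = p (inject₁ i)

end : ∀ {k} → Chain k → Fin k → Point
end p i = p (fsuc i)

SameSegment : Point → Point → Point → Point → Set
SameSegment a b c d = (a ≡ c × b ≡ d) ⊎ (a ≡ d × b ≡ c)

record CoveringTrail (n k : ℕ) (p : Chain k) : Set where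
  field
    nondegenerate : (i : Fin k) → start p i ≢ end p i
    covers : (a b : Fin n) → ∃[ i ] OnSegment (start p i) (end p i) (gridPoint a b)
    noRepeat : (i j : Fin k) → SameSegment (start p i) (end p i) (start p j) (end p j) → i ≡ j
    noCollinear : (i : Fin k) (j : Fin k) → toℕ j ≡ suc (toℕ i) →
                  ¬ Collinear (start p i) (end p i) (end p j)

record CoveringCircuit (n k : ℕ) (p : Chain k) : Set where
  field
    trail  : CoveringTrail n k p
    closed : p fzero ≡ p (fromℕ k)

-- The minimum link length of a covering trail of G_n^2 (known values,
-- as stated in the paper): 1 for n = 1, 3 for n = 2, 2(n-1) for n ≥ 3.
minTrailLength : ℕ → ℕ
minTrailLength 0 = 0
minTrailLength 1 = 1
minTrailLength 2 = 3
minTrailLength (suc n) = 2 ℕ.* n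

{-# OPTIONS --safe #-}
module Submission where

-- Let C = (n-1, n) be the point of the line y = x + 1 just above the top right
-- grid point.  The circuits constructed here run from a vertex b on that line
-- up to C, go straight down the last column, and come back to b.  Such a
-- circuit for n becomes one for n + 2: translate it by (1,1), stretch the edge
-- on y = x + 1 to the new point C, and insert four edges running once around
-- the boundary of the larger grid, from the new C to the translate of the old
-- one.  This adds 4 = 2(n+1) - 2(n-1) edges, so it is enough to start from
-- n = 4 and n = 5; for n = 2 a triangle of the same shape works.

open import Defs
open import Data.Nat using (ℕ; _≤_; zero; suc; s≤s; z≤n)
open import Data.Product using (∃-syntax; _×_; _,_; proj₁; proj₂; Σ-syntax)
import Data.Nat as ℕ
import Data.Nat.Properties as ℕ
open import Data.Integer using (+_)
import Data.Integer as ℤ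
import Data.Integer.Properties as ℤ
open import Data.Rational using (ℚ; 0ℚ; 1ℚ; _+_; _*_; _-_; -_; _÷_; _/_; ≢-nonZero; Positive; positive)
import Data.Rational as ℚ
import Data.Rational.Properties as ℚ
import Data.Rational.Unnormalised as ℚᵘ
import Data.Rational.Unnormalised.Properties as ℚᵘ
open import Data.Rational.Solver using (module +-*-Solver)
open import Data.Fin using (Fin; toℕ; fromℕ; inject₁) renaming (zero to fzero; suc to fsuc)
import Data.Fin.Properties as Fin
open import Data.Vec.Functional using (_∷_; [])
open import Data.Product.Properties using (≡-dec)
open import Data.Sum using (_⊎_; inj₁; inj₂; [_,_]′)
open import Function using (_∘_; case_of_)
open import Relation.Nullary using (¬_; Dec; yes; no; contradiction; ¬?; _×-dec_; _⊎-dec_; _→-dec_)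
open import Relation.Nullary.Decidable using (True; toWitness; map′)
open import Relation.Binary.Definitions using (DecidableEquality; tri<; tri≈; tri>)
open import Relation.Binary.PropositionalEquality using (_≡_; _≢_; refl; sym; trans; cong; cong₂; subst; subst₂; module ≡-Reasoning)

import Algebra.Properties.Group ℚ.+-0-group as ℚ+

open +-*-Solver using (solve; _:=_; _:+_; _:*_; _:-_; con)

x y : Point → ℚ
x = proj₁
y = proj₂

-- Rational arithmetic

-- `+ k / 1` is reduced by a gcd that does not compute for a variable `k`, so the equation is
-- checked on unnormalised rationals.
ℕtoℚ-suc : ∀ k → ℕtoℚ (suc k) ≡ ℕtoℚ k + 1ℚ
ℕtoℚ-suc k = ℚ.toℚᵘ-injective (begin-equality
  ℚ.toℚᵘ (ℕtoℚ (suc k))             ≃⟨ ℚ.toℚᵘ-fromℚᵘ (ℚᵘ.mkℚᵘ (+ suc k) 0) ⟩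
  ℚᵘ.mkℚᵘ (+ suc k) 0               ≃⟨ ℚᵘ.*≡* (cong (ℤ._* + 1) (sym lemma)) ⟩
  ℚᵘ.mkℚᵘ (+ k) 0 ℚᵘ.+ ℚᵘ.1ℚᵘ       ≃⟨ ℚᵘ.+-congˡ ℚᵘ.1ℚᵘ (ℚ.toℚᵘ-fromℚᵘ (ℚᵘ.mkℚᵘ (+ k) 0)) ⟨
  ℚ.toℚᵘ (ℕtoℚ k) ℚᵘ.+ ℚᵘ.1ℚᵘ       ≃⟨ ℚ.toℚᵘ-homo-+ (ℕtoℚ k) 1ℚ ⟨
  ℚ.toℚᵘ (ℕtoℚ k + 1ℚ)              ∎)
  where
  open ℚᵘ.≤-Reasoning
  lemma : + k ℤ.* + 1 ℤ.+ + 1 ℤ.* + 1 ≡ + suc k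
  lemma = trans (cong (ℤ._+ + 1) (ℤ.*-identityʳ (+ k))) (cong +_ (ℕ.+-comm k 1))

p<p+1 : ∀ p → p ℚ.< p + 1ℚ
p<p+1 p = subst (ℚ._< p + 1ℚ) (ℚ.+-identityʳ p) (ℚ.+-monoʳ-< p (ℚ.positive⁻¹ 1ℚ))

0≤ℕtoℚ : ∀ n → 0ℚ ℚ.≤ ℕtoℚ n
0≤ℕtoℚ n = ℚ.nonNegative⁻¹ (ℕtoℚ n) {{ℚ.normalize-nonNeg n 1}}

ℕtoℚ-mono-≤ : ∀ {m n} → m ℕ.≤ n → ℕtoℚ m ℚ.≤ ℕtoℚ n
ℕtoℚ-mono-≤ {n = n} z≤n = 0≤ℕtoℚ n
ℕtoℚ-mono-≤ {suc m} {suc n} (s≤s m≤n) =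
  subst₂ ℚ._≤_ (sym (ℕtoℚ-suc m)) (sym (ℕtoℚ-suc n)) (ℚ.+-monoˡ-≤ 1ℚ (ℕtoℚ-mono-≤ m≤n))

ℕtoℚ-mono-< : ∀ {m n} → m ℕ.< n → ℕtoℚ m ℚ.< ℕtoℚ n
ℕtoℚ-mono-< {m} m<n =
  ℚ.<-≤-trans (subst (ℕtoℚ m ℚ.<_) (sym (ℕtoℚ-suc m)) (p<p+1 (ℕtoℚ m))) (ℕtoℚ-mono-≤ m<n)

ℕtoℚ-injective : ∀ {m n} → ℕtoℚ m ≡ ℕtoℚ n → m ≡ n
ℕtoℚ-injective {m} {n} eq with ℕ.<-cmp m n
... | tri< m<n _ _ = contradiction (ℕtoℚ-mono-< m<n) (ℚ.<-irrefl eq)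
... | tri≈ _ m≡n _ = m≡n
... | tri> _ _ n<m = contradiction (ℕtoℚ-mono-< n<m) (ℚ.<-irrefl (sym eq))

p-q≢0 : ∀ {p q} → p ≢ q → p - q ≢ 0ℚ
p-q≢0 {p} {q} p≢q p-q≡0 =
  p≢q (trans (solve 2 (λ p q → p := (p :- q) :+ q) refl p q) (trans (cong (_+ q) p-q≡0) (ℚ.+-identityˡ q)))

p*q≢0 : ∀ {p q} → p ≢ 0ℚ → q ≢ 0ℚ → p * q ≢ 0ℚ
p*q≢0 {p} {q} p≢0 q≢0 pq≡0 = q≢0 (begin
  q                  ≡⟨ sym (ℚ.*-identityˡ q) ⟩
  1ℚ * q             ≡⟨ cong (_* q) (sym (ℚ.*-inverseˡ p)) ⟩
  (ℚ.1/ p) * p * q   ≡⟨ ℚ.*-assoc (ℚ.1/ p) p q ⟩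
  (ℚ.1/ p) * (p * q) ≡⟨ cong ((ℚ.1/ p) *_) pq≡0 ⟩
  (ℚ.1/ p) * 0ℚ      ≡⟨ ℚ.*-zeroʳ (ℚ.1/ p) ⟩
  0ℚ                 ∎)
  where
  open ≡-Reasoning
  instance _ = ≢-nonZero p≢0

interpolate : ∀ {a b c} → a ℚ.< b → a ℚ.≤ c → c ℚ.≤ b →
              Σ[ t ∈ ℚ ] (0ℚ ℚ.≤ t × t ℚ.≤ 1ℚ × c ≡ a + t * (b - a))
interpolate {a} {b} {c} a<b a≤c c≤b = t
  , ℚ.*-cancelʳ-≤-pos d (subst₂ ℚ._≤_ (sym (ℚ.*-zeroˡ d)) (sym td≡c-a)
      (subst (ℚ._≤ c - a) (ℚ.+-inverseʳ a) (ℚ.+-monoˡ-≤ (- a) a≤c)))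
  , ℚ.*-cancelʳ-≤-pos d (subst₂ ℚ._≤_ (sym td≡c-a) (sym (ℚ.*-identityˡ d)) (ℚ.+-monoˡ-≤ (- a) c≤b))
  , trans (solve 2 (λ a c → c := a :+ (c :- a)) refl a c) (cong (λ z → a + z) (sym td≡c-a))
  where
  d = b - a
  instance
    d-pos : Positive d
    d-pos = positive (subst (ℚ._< d) (ℚ.+-inverseʳ a) (ℚ.+-monoˡ-< (- a) a<b))
    d-nonZero : ℚ.NonZero d
    d-nonZero = ℚ.pos⇒nonZero d
  t = (c - a) ÷ d
  td≡c-a : t * d ≡ c - a
  td≡c-a = trans (ℚ.*-assoc (c - a) (ℚ.1/ d) d)
    (trans (cong ((c - a) *_) (ℚ.*-inverseˡ d)) (ℚ.*-identityʳ (c - a)))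

-- Plane geometry

-- A vertical edge kills one of the two terms of `cross` and leaves a product of two nonzero
-- differences. This lemma and the next suffice for every turn outside the initial chains: each
-- joins a vertical edge to a non-vertical one.
¬collinear-vertical₁ : ∀ {p q r} → x p ≡ x q → y p ≢ y q → x q ≢ x r → ¬ Collinear p q r
¬collinear-vertical₁ {px , py} {_ , qy} {rx , ry} refl py≢qy px≢rx eq =
  p*q≢0 (p-q≢0 py≢qy) (p-q≢0 (px≢rx ∘ sym))
    (trans (solve 5 (λ px py qy rx ry →
              (py :- qy) :* (rx :- px) := (px :- px) :* (ry :- py) :- (qy :- py) :* (rx :- px)) refl px py qy rx ry) eq)

¬collinear-vertical₂ : ∀ {p q r} → x p ≢ x q → x q ≡ x r → y q ≢ y r → ¬ Collinear p q r
¬collinear-vertical₂ {px , py} {qx , qy} {_ , ry} px≢qx refl qy≢ry eq =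
  p*q≢0 (p-q≢0 (px≢qx ∘ sym)) (p-q≢0 (qy≢ry ∘ sym))
    (trans (solve 5 (λ px py qx qy ry →
              (qx :- px) :* (ry :- qy) := (qx :- px) :* (ry :- py) :- (qy :- py) :* (qx :- px)) refl px py qx qy ry) eq)

OnSegment-sym : ∀ {p q g} → OnSegment p q g → OnSegment q p g
OnSegment-sym {px , py} {qx , qy} (t , 0≤t , t≤1 , gx≡ , gy≡) =
  1ℚ - t
  , subst (ℚ._≤ 1ℚ - t) (ℚ.+-inverseʳ t) (ℚ.+-monoˡ-≤ (- t) t≤1)
  , subst (1ℚ - t ℚ.≤_) (ℚ.+-identityʳ 1ℚ) (ℚ.+-monoʳ-≤ 1ℚ (ℚ.neg-antimono-≤ 0≤t))
  , trans gx≡ (reverse px qx) , trans gy≡ (reverse py qy)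
  where
  reverse : ∀ a b → a + t * (b - a) ≡ b + (1ℚ - t) * (a - b)
  reverse a b = solve 3 (λ a b t → a :+ t :* (b :- a) := b :+ (con 1ℚ :- t) :* (a :- b)) refl a b t

shift : Point → Point
shift (px , py) = px + 1ℚ , py + 1ℚ

shift-diff : ∀ p q → (q + 1ℚ) - (p + 1ℚ) ≡ q - p
shift-diff p q = solve 2 (λ p q → (q :+ con 1ℚ) :- (p :+ con 1ℚ) := q :- p) refl p q

shift-injective : ∀ {p q} → shift p ≡ shift q → p ≡ q
shift-injective eq = cong₂ _,_ (+1-injective (cong x eq)) (+1-injective (cong y eq))
  where
  +1-injective : ∀ {a b} → a + 1ℚ ≡ b + 1ℚ → a ≡ b
  +1-injective {a} {b} = ℚ+.∙-cancelʳ 1ℚ a b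

OnSegment-shift : ∀ {p q g} → OnSegment p q g → OnSegment (shift p) (shift q) (shift g)
OnSegment-shift {px , py} {qx , qy} (t , 0≤t , t≤1 , gx≡ , gy≡) =
  t , 0≤t , t≤1 , trans (cong (_+ 1ℚ) gx≡) (move px qx) , trans (cong (_+ 1ℚ) gy≡) (move py qy)
  where
  move : ∀ a b → a + t * (b - a) + 1ℚ ≡ (a + 1ℚ) + t * ((b + 1ℚ) - (a + 1ℚ))
  move a b = solve 3 (λ a b t → a :+ t :* (b :- a) :+ con 1ℚ
               := (a :+ con 1ℚ) :+ t :* ((b :+ con 1ℚ) :- (a :+ con 1ℚ))) refl a b t

Collinear-unshift : ∀ {p q r} → Collinear (shift p) (shift q) (shift r) → Collinear p q r
Collinear-unshift {px , py} {qx , qy} {rx , ry} = trans (sym (cong₂ _-_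
  (cong₂ _*_ (shift-diff px qx) (shift-diff py ry))
  (cong₂ _*_ (shift-diff py qy) (shift-diff px rx))))

pt : ℕ → ℕ → Point
pt a b = ℕtoℚ a , ℕtoℚ b

shift-pt : ∀ a b → shift (pt a b) ≡ pt (suc a) (suc b)
shift-pt a b = sym (cong₂ _,_ (ℕtoℚ-suc a) (ℕtoℚ-suc b))

x-apart : ∀ a b c d → a ≢ b → pt a c ≢ pt b d
x-apart _ _ _ _ a≢b = a≢b ∘ ℕtoℚ-injective ∘ cong x

y-apart : ∀ a b c → b ≢ c → pt a b ≢ pt a c
y-apart _ _ _ b≢c = b≢c ∘ ℕtoℚ-injective ∘ cong y

p≡p+t*0 : ∀ p t → p ≡ p + t * (p - p)
p≡p+t*0 p t = solve 2 (λ p t → p := p :+ t :* (p :- p)) refl p t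

onHorizontal : ∀ {a l} h → 0 ℕ.< l → a ℕ.≤ l → OnSegment (pt 0 h) (pt l h) (pt a h)
onHorizontal {a} h 0<l a≤l =
  let t , 0≤t , t≤1 , eq = interpolate (ℕtoℚ-mono-< 0<l) (0≤ℕtoℚ a) (ℕtoℚ-mono-≤ a≤l)
  in t , 0≤t , t≤1 , eq , p≡p+t*0 (ℕtoℚ h) t

onVertical : ∀ {b l} h → 0 ℕ.< l → b ℕ.≤ l → OnSegment (pt h 0) (pt h l) (pt h b)
onVertical {b} h 0<l b≤l =
  let t , 0≤t , t≤1 , eq = interpolate (ℕtoℚ-mono-< 0<l) (0≤ℕtoℚ b) (ℕtoℚ-mono-≤ b≤l)
  in t , 0≤t , t≤1 , p≡p+t*0 (ℕtoℚ h) t , eq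

OnDiagonal : Point → Set
OnDiagonal p = y p ≡ x p + 1ℚ

OnRay : Point → Point → Set
OnRay b g = OnDiagonal g × x b ℚ.≤ x g

diagonal-pt : ∀ {a b} → OnDiagonal (pt a b) → b ≡ suc a
diagonal-pt {a} eq = ℕtoℚ-injective (trans eq (sym (ℕtoℚ-suc a)))

diagonal-unshift : ∀ {p} → OnDiagonal (shift p) → OnDiagonal p
diagonal-unshift {px , py} = ℚ+.∙-cancelʳ 1ℚ py (px + 1ℚ)

-- On the line the two coordinates differ by the constant 1, so the parameter found for `x` also
-- serves for `y`.
onDiagonalSegment : ∀ {p q g} → OnDiagonal p → OnDiagonal q → x p ℚ.< x q →
                    OnRay p g → x g ℚ.≤ x q → OnSegment p q g
onDiagonalSegment {px , _} {qx , _} {gx , _} refl refl p<q (refl , p≤g) g≤q =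
  let t , 0≤t , t≤1 , eq = interpolate p<q p≤g g≤q
  in t , 0≤t , t≤1 , eq
  , trans (cong (_+ 1ℚ) eq) (solve 3 (λ p q t → p :+ t :* (q :- p) :+ con 1ℚ
      := (p :+ con 1ℚ) :+ t :* ((q :+ con 1ℚ) :- (p :+ con 1ℚ))) refl px qx t)

-- Trails

record IsTrail {k} (c : Chain k) : Set where
  field
    nondegenerate : ∀ i → start c i ≢ end c i
    noRepeat : ∀ i j → SameSegment (start c i) (end c i) (start c j) (end c j) → i ≡ j
    noCollinear : ∀ i j → toℕ j ≡ suc (toℕ i) → ¬ Collinear (start c i) (end c i) (end c j)

SameSegment-sym : ∀ {a b c d} → SameSegment a b c d → SameSegment c d a b
SameSegment-sym (inj₁ (a≡c , b≡d)) = inj₁ (sym a≡c , sym b≡d)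
SameSegment-sym (inj₂ (a≡d , b≡c)) = inj₂ (sym b≡c , sym a≡d)

-- This form lets `v` already be a vertex of `c`, as it is when the closing edge is added.
∷-trail : ∀ {k v} {c : Chain (suc k)} → IsTrail c → v ≢ c fzero →
          (∀ j → ¬ SameSegment v (c fzero) (start c j) (end c j)) →
          ¬ Collinear v (c fzero) (c (fsuc fzero)) → IsTrail (v ∷ c)
∷-trail {k} {v} {c} T v≢c₀ new turn = record { nondegenerate = nd ; noRepeat = nr ; noCollinear = nc }
  where
  open IsTrail T
  c′ : Chain (suc (suc k))
  c′ = v ∷ c
  nd : ∀ i → start c′ i ≢ end c′ i
  nd fzero = v≢c₀
  nd (fsuc i) = nondegenerate i
  nr : ∀ i j → SameSegment (start c′ i) (end c′ i) (start c′ j) (end c′ j) → i ≡ j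
  nr fzero fzero _ = refl
  nr fzero (fsuc j) s = contradiction s (new j)
  nr (fsuc i) fzero s = contradiction (SameSegment-sym s) (new i)
  nr (fsuc i) (fsuc j) s = cong fsuc (noRepeat i j s)
  nc : ∀ i j → toℕ j ≡ suc (toℕ i) → ¬ Collinear (start c′ i) (end c′ i) (end c′ j)
  nc fzero (fsuc fzero) _ = turn
  nc (fsuc i) (fsuc j) eq = noCollinear i j (ℕ.suc-injective eq)

-- A second copy of the new edge would have `v` as an endpoint.
∷-trail-fresh : ∀ {k v} {c : Chain (suc k)} → IsTrail c → (∀ i → v ≢ c i) →
                ¬ Collinear v (c fzero) (c (fsuc fzero)) → IsTrail (v ∷ c)
∷-trail-fresh T fresh = ∷-trail T (fresh fzero) λ where
  j (inj₁ (v≡ , _)) → fresh (inject₁ j) v≡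
  j (inj₂ (v≡ , _)) → fresh (fsuc j) v≡

shift-trail : ∀ {k} {c : Chain k} → IsTrail c → IsTrail (shift ∘ c)
shift-trail {c = c} T = record
  { nondegenerate = λ i → nondegenerate i ∘ shift-injective
  ; noRepeat = λ i j → noRepeat i j ∘ λ where
      (inj₁ (p , q)) → inj₁ (shift-injective p , shift-injective q)
      (inj₂ (p , q)) → inj₂ (shift-injective p , shift-injective q)
  ; noCollinear = λ i j eq → noCollinear i j eq ∘ Collinear-unshift {start c i} {end c i} {end c j}
  }
  where open IsTrail T

-- Closing a chain along the diagonal

-- The whole ray from the last vertex stands in for the closing edge. Unlike the segment up to C, it
-- stays valid when winding moves C further along the line.
Covered : ∀ {k} → Chain k → Point → Set
Covered {k} c g = (∃[ i ] OnSegment (start c i) (end c i) g) ⊎ OnRay (c (fromℕ k)) g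

-- The part from C to b of a circuit of the (m+1) × (m+1) grid.
record Closable (m : ℕ) {k : ℕ} (c : Chain (suc k)) : Set where
  field
    isTrail : IsTrail c
    first : c fzero ≡ pt m (suc m)
    -- The edge leaving C is vertical. This secures the turn at C from the closing edge and, after
    -- winding, the turn from the new horizontal top edge.
    second : x (c (fsuc fzero)) ≡ ℕtoℚ m
    last-diagonal : OnDiagonal (c (fromℕ (suc k)))
    last-left : x (c (fromℕ (suc k))) ℚ.< ℕtoℚ m
    -- Guarantees that the closing edge, which lies on the line, repeats no edge of `c`.
    chordless : ∀ i → ¬ (OnDiagonal (start c i) × OnDiagonal (end c i))
    -- After translation every old vertex lies strictly between columns 0 and m + 2, where all new
    -- vertices are placed. Heights may leave the grid, as in `chain₅`.
    bounded : ∀ i → - 1ℚ ℚ.< x (c i) × x (c i) ℚ.< ℕtoℚ (suc m)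
    covers : ∀ {a b} → a ℕ.< suc m → b ℕ.< suc m → Covered c (pt a b)

  first-x : x (c fzero) ≡ ℕtoℚ m
  first-x = cong x first

  first-diagonal : OnDiagonal (c fzero)
  first-diagonal = trans (cong y first) (trans (ℕtoℚ-suc m) (cong (_+ 1ℚ) (sym first-x)))

  second-y : y (c fzero) ≢ y (c (fsuc fzero))
  second-y eq = IsTrail.nondegenerate isTrail fzero (cong₂ _,_ (trans first-x (sym second)) eq)

close : ∀ {m k} {c : Chain (suc k)} → Closable m c → ∃[ p ] CoveringCircuit (suc m) (suc (suc k)) p
close {m} {k} {c} B = p , record
  { trail = record
    { nondegenerate = nondegenerate
    ; covers = λ a b → cover (toℕ a) (toℕ b) (Fin.toℕ<n a) (Fin.toℕ<n b)
    ; noRepeat = noRepeat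
    ; noCollinear = noCollinear
    }
  ; closed = refl
  }
  where
  open Closable B
  b = c (fromℕ (suc k))
  p : Chain (suc (suc k))
  p = b ∷ c
  b<C : x b ℚ.< x (c fzero)
  b<C = subst (x b ℚ.<_) (sym first-x) last-left
  trail : IsTrail p
  -- The vertex `b` already ends `c`, so freshness fails here and `chordless` replaces it.
  trail = ∷-trail isTrail (λ eq → ℚ.<-irrefl (cong x eq) b<C)
    (λ where
      j (inj₁ (b≡ , C≡)) → chordless j (subst OnDiagonal b≡ last-diagonal , subst OnDiagonal C≡ first-diagonal)
      j (inj₂ (b≡ , C≡)) → chordless j (subst OnDiagonal C≡ first-diagonal , subst OnDiagonal b≡ last-diagonal))
    (¬collinear-vertical₂ (λ eq → ℚ.<-irrefl eq b<C) (trans first-x (sym second)) second-y)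
  open IsTrail trail
  cover : ∀ a a′ → a ℕ.< suc m → a′ ℕ.< suc m → ∃[ i ] OnSegment (start p i) (end p i) (pt a a′)
  cover a a′ a<n a′<n =
    [ (λ (i , on) → fsuc i , on)
    -- The ray runs on beyond C, but no grid point has abscissa larger than m, that of C.
    , (λ ray → fzero , onDiagonalSegment last-diagonal first-diagonal b<C ray
         (subst (ℕtoℚ a ℚ.≤_) (sym first-x) (ℕtoℚ-mono-≤ (ℕ.≤-pred a<n))))
    ]′ (covers a<n a′<n)

-- Winding once around the larger grid

wind : ∀ (m : ℕ) {k} → Chain (suc k) → Chain (suc (4 ℕ.+ k))
-- The top edge ends at the translated old C, (m + 1, m + 2), one column short of the corner. The
-- corner is left to the right edge, which rises to the new C at height m + 3.
wind m c = pt (2 ℕ.+ m) (3 ℕ.+ m) ∷ pt (2 ℕ.+ m) 0 ∷ pt 0 0 ∷ pt 0 (2 ℕ.+ m) ∷ shift ∘ c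

wind-closable : ∀ {m k} {c : Chain (suc k)} → Closable m c → Closable (2 ℕ.+ m) (wind m c)
wind-closable {m} {k} {c} B = record
  { isTrail = trail₀
  ; first = refl
  ; second = refl
  ; last-diagonal = cong (_+ 1ℚ) last-diagonal
  ; last-left = ℚ.<-trans (subst (x b + 1ℚ ℚ.<_) (sym (ℕtoℚ-suc m)) (ℚ.+-monoˡ-< 1ℚ last-left))
      (ℕtoℚ-mono-< (ℕ.n<1+n (suc m)))
  ; chordless = chordless′
  ; bounded = bounded′
  ; covers = covers′
  }
  where
  open Closable B
  b = c (fromℕ (suc k))
  c₄ = shift ∘ c
  c₃ : Chain (2 ℕ.+ k)
  c₃ = pt 0 (2 ℕ.+ m) ∷ c₄
  c₂ : Chain (3 ℕ.+ k)
  c₂ = pt 0 0 ∷ c₃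
  c₁ : Chain (4 ℕ.+ k)
  c₁ = pt (2 ℕ.+ m) 0 ∷ c₂

  corner : c₄ fzero ≡ pt (1 ℕ.+ m) (2 ℕ.+ m)
  corner = trans (cong shift first) (shift-pt m (suc m))

  0<x : ∀ i → 0ℚ ℚ.< x (c₄ i)
  0<x i = ℚ.+-monoˡ-< 1ℚ (proj₁ (bounded i))

  x<2+m : ∀ i → x (c₄ i) ℚ.< ℕtoℚ (2 ℕ.+ m)
  x<2+m i = subst (x (c₄ i) ℚ.<_) (sym (ℕtoℚ-suc (suc m))) (ℚ.+-monoˡ-< 1ℚ (proj₂ (bounded i)))

  left-apart : ∀ h i → pt 0 h ≢ c₄ i
  left-apart h i eq = ℚ.<-irrefl (cong x eq) (0<x i)

  right-apart : ∀ h i → pt (2 ℕ.+ m) h ≢ c₄ i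
  right-apart h i eq = ℚ.<-irrefl (cong x (sym eq)) (x<2+m i)

  trail₃ : IsTrail c₃
  trail₃ = ∷-trail-fresh (shift-trail isTrail) (left-apart (2 ℕ.+ m))
    -- At the old C the horizontal top edge meets the translated vertical edge given by `second`.
    (¬collinear-vertical₂ (λ eq → ℚ.<-irrefl eq (0<x fzero))
      (cong (_+ 1ℚ) (trans first-x (sym second)))
      (second-y ∘ ℚ+.∙-cancelʳ 1ℚ _ _))

  trail₂ : IsTrail c₂
  trail₂ = ∷-trail-fresh trail₃
    (λ where
      fzero → y-apart 0 0 (2 ℕ.+ m) λ ()
      (fsuc i) → left-apart 0 i)
    (¬collinear-vertical₁ {pt 0 0} {pt 0 (2 ℕ.+ m)} {c₄ fzero} refl
      ((λ ()) ∘ ℕtoℚ-injective {0} {2 ℕ.+ m}) (λ eq → ℚ.<-irrefl eq (0<x fzero)))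

  trail₁ : IsTrail c₁
  trail₁ = ∷-trail-fresh trail₂
    (λ where
      fzero → x-apart (2 ℕ.+ m) 0 0 0 λ ()
      (fsuc fzero) → x-apart (2 ℕ.+ m) 0 0 (2 ℕ.+ m) λ ()
      (fsuc (fsuc i)) → right-apart 0 i)
    (¬collinear-vertical₂ {pt (2 ℕ.+ m) 0} {pt 0 0} {pt 0 (2 ℕ.+ m)}
      ((λ ()) ∘ ℕtoℚ-injective {2 ℕ.+ m} {0}) refl ((λ ()) ∘ ℕtoℚ-injective {0} {2 ℕ.+ m}))

  trail₀ : IsTrail (wind m c)
  trail₀ = ∷-trail-fresh trail₁
    (λ where
      fzero → y-apart (2 ℕ.+ m) (3 ℕ.+ m) 0 λ ()
      (fsuc fzero) → x-apart (2 ℕ.+ m) 0 (3 ℕ.+ m) 0 λ ()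
      (fsuc (fsuc fzero)) → x-apart (2 ℕ.+ m) 0 (3 ℕ.+ m) (2 ℕ.+ m) λ ()
      (fsuc (fsuc (fsuc i))) → right-apart (3 ℕ.+ m) i)
    (¬collinear-vertical₁ {pt (2 ℕ.+ m) (3 ℕ.+ m)} {pt (2 ℕ.+ m) 0} {pt 0 0} refl
      ((λ ()) ∘ ℕtoℚ-injective {3 ℕ.+ m} {0}) ((λ ()) ∘ ℕtoℚ-injective {2 ℕ.+ m} {0}))

  -- Each of the four new edges has an endpoint off the line: (m + 2, 0), (0, 0) or (0, m + 2).
  -- Translation by (1,1) preserves the line, which settles the old edges.
  chordless′ : ∀ i → ¬ (OnDiagonal (start (wind m c) i) × OnDiagonal (end (wind m c) i))
  chordless′ fzero (_ , d) = case diagonal-pt {2 ℕ.+ m} {0} d of λ ()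
  chordless′ (fsuc fzero) (d , _) = case diagonal-pt {2 ℕ.+ m} {0} d of λ ()
  chordless′ (fsuc (fsuc fzero)) (d , _) = case diagonal-pt {0} {0} d of λ ()
  chordless′ (fsuc (fsuc (fsuc fzero))) (d , _) = case diagonal-pt {0} {2 ℕ.+ m} d of λ ()
  chordless′ (fsuc (fsuc (fsuc (fsuc i)))) (d , d′) =
    chordless i (diagonal-unshift {start c i} d , diagonal-unshift {end c i} d′)

  bounded-pt : ∀ a h → a ℕ.< 3 ℕ.+ m → - 1ℚ ℚ.< x (pt a h) × x (pt a h) ℚ.< ℕtoℚ (3 ℕ.+ m)
  bounded-pt a _ a<3+m = ℚ.<-≤-trans (ℚ.negative⁻¹ (- 1ℚ)) (0≤ℕtoℚ a) , ℕtoℚ-mono-< a<3+m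

  bounded′ : ∀ i → - 1ℚ ℚ.< x (wind m c i) × x (wind m c i) ℚ.< ℕtoℚ (3 ℕ.+ m)
  bounded′ fzero = bounded-pt (2 ℕ.+ m) (3 ℕ.+ m) (ℕ.n<1+n _)
  bounded′ (fsuc fzero) = bounded-pt (2 ℕ.+ m) 0 (ℕ.n<1+n _)
  bounded′ (fsuc (fsuc fzero)) = bounded-pt 0 0 ℕ.z<s
  bounded′ (fsuc (fsuc (fsuc fzero))) = bounded-pt 0 (2 ℕ.+ m) ℕ.z<s
  bounded′ (fsuc (fsuc (fsuc (fsuc i)))) =
    ℚ.<-trans (ℚ.negative⁻¹ (- 1ℚ)) (0<x i) , ℚ.<-trans (x<2+m i) (ℕtoℚ-mono-< (ℕ.n<1+n (2 ℕ.+ m)))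

  covers-shift : ∀ {g} → Covered c g → Covered (wind m c) (shift g)
  covers-shift (inj₁ (i , on)) = inj₁ (fsuc (fsuc (fsuc (fsuc i))) , OnSegment-shift {start c i} {end c i} on)
  covers-shift (inj₂ (d , b≤g)) = inj₂ (cong (_+ 1ℚ) d , ℚ.+-monoˡ-≤ 1ℚ b≤g)

  covers-suc : ∀ {a b} → a ℕ.< suc m ⊎ a ≡ suc m → b ℕ.< suc m ⊎ b ≡ suc m →
               Covered (wind m c) (pt (suc a) (suc b))
  covers-suc {a} {b} (inj₁ a<) (inj₁ b<) =
    subst (Covered (wind m c)) (shift-pt a b) (covers-shift (covers a< b<))
  -- `a<` says precisely that the point is not to the right of the translated C.
  covers-suc {a} (inj₁ a<) (inj₂ refl) =
    inj₁ (fsuc (fsuc (fsuc fzero)) , subst (λ q → OnSegment (pt 0 (2 ℕ.+ m)) q (pt (suc a) (2 ℕ.+ m)))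
      (sym corner) (onHorizontal (2 ℕ.+ m) ℕ.z<s a<))
  covers-suc {b = b} (inj₂ refl) b≤ =
    inj₁ (fzero , OnSegment-sym {pt (2 ℕ.+ m) 0} {pt (2 ℕ.+ m) (3 ℕ.+ m)}
      (onVertical (2 ℕ.+ m) ℕ.z<s (s≤s (ℕ.m≤n⇒m≤1+n ([ ℕ.<⇒≤ , ℕ.≤-reflexive ]′ b≤)))))

  covers′ : ∀ {a b} → a ℕ.< 3 ℕ.+ m → b ℕ.< 3 ℕ.+ m → Covered (wind m c) (pt a b)
  covers′ {zero} {b} _ b< = inj₁ (fsuc (fsuc fzero) , onVertical 0 ℕ.z<s (ℕ.≤-pred b<))
  covers′ {suc a} {zero} a< _ =
    inj₁ (fsuc fzero , OnSegment-sym {pt 0 0} {pt (2 ℕ.+ m) 0} (onHorizontal 0 ℕ.z<s (ℕ.≤-pred a<)))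
  covers′ {suc a} {suc b} (s≤s (s≤s a≤)) (s≤s (s≤s b≤)) = covers-suc (ℕ.m≤n⇒m<n∨m≡n a≤) (ℕ.m≤n⇒m<n∨m≡n b≤)

-- Initial chains, checked by computation

_≟ᴾ_ : DecidableEquality Point
_≟ᴾ_ = ≡-dec ℚ._≟_ ℚ._≟_

isTrail? : ∀ {k} (c : Chain k) → Dec (IsTrail c)
isTrail? c = map′
  (λ (nd , nr , nc) → record { nondegenerate = nd ; noRepeat = nr ; noCollinear = nc })
  (λ T → IsTrail.nondegenerate T , IsTrail.noRepeat T , IsTrail.noCollinear T)
  (Fin.all? (λ i → ¬? (start c i ≟ᴾ end c i))
   ×-dec Fin.all? (λ i → Fin.all? λ j → sameSegment? (start c i) (end c i) (start c j) (end c j) →-dec i Fin.≟ j)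
   ×-dec Fin.all? (λ i → Fin.all? λ j → (toℕ j ℕ.≟ suc (toℕ i)) →-dec ¬? (cross (start c i) (end c i) (end c j) ℚ.≟ 0ℚ)))
  where
  sameSegment? : ∀ a b c d → Dec (SameSegment a b c d)
  sameSegment? a b c d = ((a ≟ᴾ c) ×-dec (b ≟ᴾ d)) ⊎-dec ((a ≟ᴾ d) ×-dec (b ≟ᴾ c))

onDiagonal? : ∀ p → Dec (OnDiagonal p)
onDiagonal? p = y p ℚ.≟ x p + 1ℚ

-- The parameter of the orthogonal projection of g to the line pq (0 if p = q):
-- the only t that can witness OnSegment p q g.
projection : Point → Point → Point → ℚ
projection (px , py) (qx , qy) (gx , gy) with (qx - px) * (qx - px) + (qy - py) * (qy - py)
... | d with d ℚ.≟ 0ℚ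
...   | yes _ = 0ℚ
...   | no d≢0 = _÷_ ((gx - px) * (qx - px) + (gy - py) * (qy - py)) d {{≢-nonZero d≢0}}

-- Fixing the parameter removes the quantifier over ℚ from `OnSegment` and leaves a decidable
-- condition.
Through : Point → Point → Point → Set
Through p@(px , py) q@(qx , qy) g@(gx , gy) = let t = projection p q g in
  0ℚ ℚ.≤ t × t ℚ.≤ 1ℚ × gx ≡ px + t * (qx - px) × gy ≡ py + t * (qy - py)

through? : ∀ p q g → Dec (Through p q g)
through? p q g = (0ℚ ℚ.≤? _) ×-dec (_ ℚ.≤? 1ℚ) ×-dec (_ ℚ.≟ _) ×-dec (_ ℚ.≟ _)

covered? : ∀ {k} (c : Chain k) g →
  Dec ((∃[ i ] Through (start c i) (end c i) g) ⊎ OnRay (c (fromℕ k)) g)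
covered? c g = Fin.any? (λ i → through? (start c i) (end c i) g)
  ⊎-dec (onDiagonal? g ×-dec (x (c (fromℕ _)) ℚ.≤? x g))

closable : ∀ m {k} (c : Chain (suc k)) →
  True (isTrail? c
        ×-dec (c fzero ≟ᴾ pt m (suc m))
        ×-dec (x (c (fsuc fzero)) ℚ.≟ ℕtoℚ m)
        ×-dec onDiagonal? (c (fromℕ (suc k)))
        ×-dec (x (c (fromℕ (suc k))) ℚ.<? ℕtoℚ m)
        ×-dec Fin.all? (λ i → ¬? (onDiagonal? (start c i) ×-dec onDiagonal? (end c i)))
        ×-dec Fin.all? (λ i → (- 1ℚ ℚ.<? x (c i)) ×-dec (x (c i) ℚ.<? ℕtoℚ (suc m)))
        ×-dec ℕ.allUpTo? (λ a → ℕ.allUpTo? (λ b → covered? c (pt a b)) (suc m)) (suc m)) →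
  Closable m c
closable m c ok = let T , c₀ , c₁ , d , l , ch , bd , cov = toWitness ok in record
  { isTrail = T ; first = c₀ ; second = c₁ ; last-diagonal = d ; last-left = l
  ; chordless = ch ; bounded = bd
  -- The parameter left as `_` is the value of `projection`.
  ; covers = λ a< b< → [ (λ (i , on) → inj₁ (i , _ , on)) , inj₂ ]′ (cov a< b<)
  }

-- With the closing edge, a triangle with sides on x = 1, x + y = 0 and y = x + 1.
chain₂ : Chain 2
chain₂ = pt 1 2 ∷ (1ℚ , - 1ℚ) ∷ (- ℚ.½ , ℚ.½) ∷ []

-- The left side overshoots to (0, 4) so that the next edge, on x + y = 4, meets (1, 3), (2, 2) and
-- (3, 1). The row y = 1 and the closing edge cover the remaining inner points.
chain₄ : Chain 5
chain₄ = pt 3 4 ∷ pt 3 0 ∷ pt 0 0 ∷ pt 0 4 ∷ pt 3 1 ∷ pt 0 1 ∷ []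

-- The edges lie in turn on x = 4, x + y = 4, x = 0, y = x - 1, x + y = 6, y = 6 - 2x and x + y = 2.
-- The last meets y = x + 1 at (1/2, 3/2).
chain₅ : Chain 7
chain₅ = pt 4 5 ∷ pt 4 0 ∷ pt 0 4 ∷ (0ℚ , - 1ℚ) ∷ (+ 7 / 2 , + 5 / 2)
       ∷ pt 0 6 ∷ (ℕtoℚ 4 , - ℕtoℚ 2) ∷ (ℚ.½ , + 3 / 2) ∷ []

-- Induction in steps of two

spiral : ∀ j → Σ[ k ∈ ℕ ] Σ[ c ∈ Chain (suc k) ] (Closable (3 ℕ.+ j) c × 2 ℕ.+ k ≡ minTrailLength (4 ℕ.+ j))
-- The even case cannot start from `chain₂`: winding the triangle gives 3 + 4 = 7 edges for n = 4,
-- one more than the minimum.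
spiral 0 = 4 , chain₄ , closable 3 chain₄ _ , refl
spiral 1 = 6 , chain₅ , closable 4 chain₅ _ , refl
spiral (suc (suc j)) = let k , c , B , eq = spiral j in
  4 ℕ.+ k , wind (3 ℕ.+ j) c , wind-closable B
    , trans (cong (4 ℕ.+_) eq) (lemma j)
  where
  lemma : ∀ j → 4 ℕ.+ 2 ℕ.* (3 ℕ.+ j) ≡ 2 ℕ.* (5 ℕ.+ j)
  lemma j = sym (ℕ.*-distribˡ-+ 2 2 (3 ℕ.+ j))

theorem2p2 : (n : ℕ) → 2 ≤ n → n ≢ 3 →
    ∃[ p ] CoveringCircuit n (minTrailLength n) p
theorem2p2 1 (s≤s ()) _
theorem2p2 2 _ _ = close (closable 1 chain₂ _)
theorem2p2 3 _ n≢3 = contradiction refl n≢3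
theorem2p2 (suc (suc (suc (suc j)))) _ _ = let k , c , B , eq = spiral j in
  subst (λ l → ∃[ p ] CoveringCircuit (4 ℕ.+ j) l p) eq (close B)
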